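{- Let $\lambda$ be an infinite cardinal and assume $2^{<\lambda}>\lambda$. Then there is a continuous weak $\lambda^+$-measure space $({}^{\lambda}2,\mathfrak{M},\mu)$ on ${}^{\lambda}2$ (with $\mu$ taking values in some positively totally ordered monoid $\mathbb{S}$ with an infinitary sum $\mathsf{Sum}$).
   Context: **Topology.** ${}^{\lambda}2$ is the set of functions from $\lambda$ to $2=\{0,1\}$, with the bounded topology, generated by the cones $\mathbf{N}_s=\{x\in{}^{\lambda}2\mid s\subseteq x\}$ for $s\in{}^{<\lambda}2=\bigcup_{\alpha<\lambda}{}^{\alpha}2$. $2^{<\lambda}=\sup\{2^{\theta}\mid\theta<\lambda\text{ a cardinal}\}$. **Monoids and sums.** A positively totally ordered monoid is $\mathbb{S}=(S,0,+,\leq)$ where $+$ is associative (not necessarily commutative) with neutral element $0$, $\leq$ is a total order, $a\leq b$ and $c\leq d$ imply $a+c\leq b+d$, $0$ is the minimum of $\leq$, and $S\neq\{0\}$. ${}^{<\mathrm{On}}\mathbb{S}$ is the class of all sequences of elements of $S$ of ordinal length; $\mathrm{lh}(s)$ is the length of $s$. An infinitary sum on $\mathbb{S}$ is a partial function $\mathsf{Sum}:{}^{<\mathrm{On}}\mathbb{S}\to\mathbb{S}$ such that: (S1) $\mathsf{Sum}(\emptyset)=0$ and $\mathsf{Sum}(s)=s_0+\dots+s_n$ for every non-empty finite $s=(s_i)_{i\leq n}\in\mathrm{dom}(\mathsf{Sum})$; (S2) (continuity) for all $s\in\mathrm{dom}(\mathsf{Sum})$ of limit length, if $s\restriction\alpha\in\mathrm{dom}(\mathsf{Sum})$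 for cofinally many $\alpha<\mathrm{lh}(s)$, then $\mathsf{Sum}(s)=\sup\{\mathsf{Sum}(s\restriction\alpha)\mid\alpha<\mathrm{lh}(s),\ s\restriction\alpha\in\mathrm{dom}(\mathsf{Sum})\}$. **Measures.** A weakly $\lambda^+$-measurable space is a pair $(X,\mathfrak{M})$ where $X$ is a topological space and $\mathfrak{M}$ is a family of subsets of $X$ closed under unions of size $\leq\lambda$ and containing all open subsets of $X$. A $\lambda^+$-measure on it (with values in $(\mathbb{S},\mathsf{Sum})$) is a partial function $\mu:\mathscr{P}(X)\to\mathbb{S}$ with $\mathfrak{M}\subseteq\mathrm{dom}(\mu)$ such that: (M1) $\mu(\emptyset)=0$; (M2) $\mu(X)>0$; (M3) $A\subseteq B$ implies $\mu(A)\leq\mu(B)$ for all $A,B\in\mathfrak{M}$; (M4) for every family $(A_i)_{i<\gamma}$ of pairwise disjoint sets of $\mathfrak{M}$ of length an ordinal $\gamma<\lambda^+$, we have $\langle\mu(A_i)\mid i<\gamma\rangle\in\mathrm{dom}(\mathsf{Sum})$ and $\mu(\bigcup_{i<\gamma}A_i)=\mathsf{Sum}(\langle\mu(A_i)\mid i<\gamma\rangle)$; (M5) for every $x\in X$ with $\{x\}\in\mathfrak{M}$ and every open local basis $\{A_i\mid i<\gamma\}$ at $x$ with $\gamma<\lambda^+$, $\mu(\{x\})=\inf_{i<\gamma}\mu(A_i)$. Then $(X,\mathfrak{M},\mu)$ is called a weak $\lambda^+$-measure space. It is continuous if $\{x\}\in\mathfrak{M}$ and $\mu(\{x\})=0$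 for every $x\in X$. -}

module Defs where

open import Level using (0ℓ; _⊔_; Setω) renaming (suc to lsuc)
open import Algebra.Bundles using (Monoid)
import Algebra.Properties.Monoid.Sum as MonoidSum
open import Axiom.ExcludedMiddle using (ExcludedMiddle)
open import Data.Bool.Base using (Bool)
open import Data.Fin.Base as Fin using (Fin)
import Data.Fin.Induction as Fin
import Data.Fin.Properties as Fin
open import Data.Nat.Base using (ℕ; suc)
open import Data.Product.Base using (Σ; ∃; _×_; _,_; proj₁; proj₂; map₂)
open import Data.Sum.Base using (_⊎_)
open import Function.Base using (_∘_; _on_)
open import Function.Bundles using (Injection; _↣_; _↔_; module Inverse)
open import Induction.WellFounded using (WellFounded)
open import Relation.Binary.Bundles using (Setoid)
open import Relation.Binary.Core using (Rel)
open import Relation.Binary.Definitions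
  using (Irrelevant; Transitive; Trichotomous; Minimum; tri<; tri≈; tri>; _Respects_)
open import Relation.Binary.PropositionalEquality
  using (_≡_; refl; sym; trans; cong; setoid; isEquivalence; _→-setoid_)
open import Relation.Binary.Structures using (IsStrictTotalOrder; IsTotalOrder)
import Relation.Binary.Construct.On as On
open import Relation.Nullary.Negation.Core using (¬_)
open import Relation.Unary as Pred using (Pred)

-- Sets are modelled by types in Set (up to a setoid equality where needed),
-- proper classes and families of subsets by types and predicates in Set₁.

-- The ambient theory is ZFC.  ExcludedMiddle decides arbitrary types, not
-- only propositions, so it also provides choice.
Classical : Setω
Classical = ∀ {ℓ} → ExcludedMiddle ℓ

-- An ordinal is represented by any well-ordered set of that order type.
-- Irrelevance of _<_ makes (β , p) and (β , q) equal elements of a segment.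
record Ordinal : Set₁ where
  infix 4 _<_
  field
    Carrier            : Set
    _<_                : Rel Carrier 0ℓ
    isStrictTotalOrder : IsStrictTotalOrder _≡_ _<_
    <-wellFounded      : WellFounded _<_
    <-irrelevant       : Irrelevant _<_

∣_∣ : Ordinal → Set
∣_∣ = Ordinal.Carrier

Segment : (α : Ordinal) → ∣ α ∣ → Set
Segment α a = ∃ λ b → Ordinal._<_ α b a

-- The ordinals smaller than α are, up to isomorphism, exactly the α ↓ a.
_↓_ : (α : Ordinal) → ∣ α ∣ → Ordinal
α ↓ a = record
  { Carrier            = Segment α a
  ; _<_                = _<_ on proj₁
  ; isStrictTotalOrder = record
    { isStrictPartialOrder = record
      { isEquivalence = isEquivalence
      ; irrefl        = λ { refl → irrefl refl }
      ; trans         = <-trans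
      ; <-resp-≈      = (λ { refl p → p }) , (λ { refl p → p })
      }
    ; compare = cmp
    }
  ; <-wellFounded      = On.wellFounded proj₁ <-wellFounded
  ; <-irrelevant       = <-irrelevant
  }
  where
  open Ordinal α
  open IsStrictTotalOrder isStrictTotalOrder
    using (irrefl; compare) renaming (trans to <-trans)

  segment-≡ : {x y : Segment α a} → proj₁ x ≡ proj₁ y → x ≡ y
  segment-≡ {b , p} {_ , q} refl = cong (b ,_) (<-irrelevant p q)

  cmp : Trichotomous {A = Segment α a} _≡_ (_<_ on proj₁)
  cmp x y with compare (proj₁ x) (proj₁ y)
  ... | tri< p ¬q ¬r = tri< p (¬q ∘ cong proj₁) ¬r
  ... | tri≈ ¬p q ¬r = tri≈ ¬p (segment-≡ q) ¬r
  ... | tri> ¬p ¬q r = tri> ¬p (¬q ∘ cong proj₁) r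

finite : ℕ → Ordinal
finite n = record
  { Carrier            = Fin n
  ; _<_                = Fin._<_
  ; isStrictTotalOrder = Fin.<-isStrictTotalOrder
  ; <-wellFounded      = Fin.<-wellFounded
  ; <-irrelevant       = Fin.<-irrelevant
  }

IsLimit : Ordinal → Set
IsLimit α = Carrier × (∀ a → ∃ λ b → a < b)
  where open Ordinal α

infix 4 _≅_
record _≅_ (α β : Ordinal) : Set where
  field
    bijection : ∣ α ∣ ↔ ∣ β ∣
  open Inverse bijection public using (to)
  field
    mono : ∀ {a b} → Ordinal._<_ α a b → Ordinal._<_ β (to a) (to b)

infix 4 _≼_ _≺_

_≼_ : Setoid 0ℓ 0ℓ → Setoid 0ℓ 0ℓ → Set
A ≼ B = Injection A B

_≺_ : Setoid 0ℓ 0ℓ → Setoid 0ℓ 0ℓ → Set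
A ≺ B = A ≼ B × ¬ (B ≼ A)

setOf : Ordinal → Setoid 0ℓ 0ℓ
setOf α = setoid ∣ α ∣

IsCardinal : Ordinal → Set
IsCardinal α = ∀ a → setOf (α ↓ a) ≺ setOf α

IsInfinite : Ordinal → Set
IsInfinite α = ¬ (∃ λ n → ∣ α ∣ ↔ Fin n)

-- γ < Λ⁺, where the successor cardinal Λ⁺ of Λ is the set of all ordinals of
-- cardinality at most that of Λ.
_<⁺_ : Ordinal → Ordinal → Set
γ <⁺ Λ = setOf γ ≼ setOf Λ

-- The set ᵅ2, as functions up to pointwise equality.
2^ : Ordinal → Setoid 0ℓ 0ℓ
2^ α = ∣ α ∣ →-setoid Bool

-- κ = 2^{<Λ}, i.e. κ is the supremum of the cardinals ∣ᶿ2∣ for θ < Λ a cardinal.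
record _Is2^<_ (κ Λ : Ordinal) : Set₁ where
  field
    isCardinal : IsCardinal κ
    upperBound : ∀ a → IsCardinal (Λ ↓ a) → 2^ (Λ ↓ a) ≼ setOf κ
    least      : ∀ κ′ → IsCardinal κ′ →
                 (∀ a → IsCardinal (Λ ↓ a) → 2^ (Λ ↓ a) ≼ setOf κ′) →
                 setOf κ ≼ setOf κ′

-- Partial functions are given by their graphs, compatible with both equalities.
record PartialFunction {a r} {A : Set a} (_≈₁_ : Rel A r)
                       {B : Set} (_≈₂_ : Rel B 0ℓ) : Set (a ⊔ r ⊔ lsuc (lsuc 0ℓ)) where
  field
    Graph      : A → B → Set₁
    respects   : ∀ {x y u v} → x ≈₁ y → u ≈₂ v → Graph x u → Graph y v
    functional : ∀ {x u v} → Graph x u → Graph x v → u ≈₂ v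

  Dom : A → Set₁
  Dom x = ∃ λ u → Graph x u

record PositivelyTotallyOrderedMonoid : Set₁ where
  field
    monoid : Monoid 0ℓ 0ℓ
  open Monoid monoid public
    renaming (_∙_ to _+_; ε to 0#)
    using (Carrier; _≈_)
  infix 4 _≤_ _<_
  field
    _≤_          : Rel Carrier 0ℓ
    isTotalOrder : IsTotalOrder _≈_ _≤_
    +-mono-≤     : ∀ {a b c d} → a ≤ b → c ≤ d → (a + c) ≤ (b + d)
    0-minimum    : Minimum _≤_ 0#
    nontrivial   : ∃ λ a → ¬ (a ≈ 0#)

  _<_ : Rel Carrier 0ℓ
  a < b = a ≤ b × ¬ (a ≈ b)

  IsSup : ∀ {i} {I : Set i} → (I → Carrier) → Carrier → Set i
  IsSup f v = (∀ i → f i ≤ v) × (∀ u → (∀ i → f i ≤ u) → v ≤ u)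

  IsInf : ∀ {i} {I : Set i} → (I → Carrier) → Carrier → Set i
  IsInf f v = (∀ i → v ≤ f i) × (∀ u → (∀ i → u ≤ f i) → u ≤ v)

  Sequence : Set₁
  Sequence = Σ Ordinal λ γ → ∣ γ ∣ → Carrier

  -- Sequences are the same when their lengths are isomorphic and their terms
  -- agree along the (unique) isomorphism.
  _∼_ : Rel Sequence 0ℓ
  (γ , s) ∼ (δ , t) = Σ (γ ≅ δ) λ f → ∀ i → s i ≈ t (_≅_.to f i)

  _↾_ : (s : Sequence) → ∣ proj₁ s ∣ → Sequence
  (γ , s) ↾ a = (γ ↓ a) , s ∘ proj₁

  open MonoidSum monoid public using (sum)

record InfinitarySum (𝕊 : PositivelyTotallyOrderedMonoid) : Set₂ where
  open PositivelyTotallyOrderedMonoid 𝕊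
  field
    partialFunction : PartialFunction _∼_ _≈_
  open PartialFunction partialFunction public renaming (Graph to Sum_≈_)
  field
    sum-empty  : ∀ (s : Fin 0 → Carrier) → Sum (finite 0 , s) ≈ 0#
    sum-finite : ∀ n (s : Fin (suc n) → Carrier) v →
                 Sum (finite (suc n) , s) ≈ v → v ≈ sum s
    continuity : ∀ s v → Sum s ≈ v → IsLimit (proj₁ s) →
                 (∀ a → ∃ λ b → (a ≡ b ⊎ Ordinal._<_ (proj₁ s) a b) × Dom (s ↾ b)) →
                 IsSup {I = ∃ λ a → Dom (s ↾ a)} (λ (_ , w , _) → w) v

module _ (X : Setoid 0ℓ 0ℓ) where
  open Setoid X using (Carrier; _≈_)

  record Subset : Set₁ where
    field
      pred : Pred Carrier 0ℓ
      resp : pred Respects _≈_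

module _ {X : Setoid 0ℓ 0ℓ} where
  private module X = Setoid X
  open Subset

  infix 4 _∈_ _⊆_ _≐_

  _∈_ : X.Carrier → Subset X → Set
  x ∈ A = pred A x

  _⊆_ _≐_ : Rel (Subset X) 0ℓ
  A ⊆ B = pred A Pred.⊆ pred B
  A ≐ B = pred A Pred.≐ pred B

  Disjoint : Rel (Subset X) 0ℓ
  Disjoint A B = pred A Pred.⊥ pred B

  ∅ : Subset X
  ∅ = record { pred = Pred.∅ ; resp = λ _ () }

  whole : Subset X
  whole = record { pred = Pred.U ; resp = λ _ _ → _ }

  singleton : X.Carrier → Subset X
  singleton x = record { pred = x X.≈_ ; resp = λ p q → X.trans q p }

  _∩_ : Subset X → Subset X → Subset X
  A ∩ B = record
    { pred = pred A Pred.∩ pred B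
    ; resp = λ p (a , b) → resp A p a , resp B p b
    }

  ⋃ : {I : Set} → (I → Subset X) → Subset X
  ⋃ {I} A = record
    { pred = Pred.⋃ I (pred ∘ A)
    ; resp = λ p → map₂ (λ {i} → resp (A i) p)
    }

record Topology (X : Setoid 0ℓ 0ℓ) : Set₂ where
  field
    Open       : Pred (Subset X) (lsuc 0ℓ)
    open-resp  : Open Respects _≐_
    open-whole : Open whole
    open-∩     : ∀ {A B} → Open A → Open B → Open (A ∩ B)
    open-⋃     : ∀ {I : Set} (A : I → Subset X) → (∀ i → Open (A i)) → Open (⋃ A)

  IsOpenLocalBasis : Setoid.Carrier X → {I : Set} → (I → Subset X) → Set₁
  IsOpenLocalBasis x A =
    (∀ i → Open (A i) × x ∈ A i) ×
    (∀ U → Open U → x ∈ U → ∃ λ i → A i ⊆ U)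

data GeneratedOpen {X : Setoid 0ℓ 0ℓ} {J : Set} (B : J → Subset X)
                   : Pred (Subset X) (lsuc 0ℓ) where
  base : ∀ j → GeneratedOpen B (B j)
  resp : GeneratedOpen B Respects _≐_
  all  : GeneratedOpen B whole
  meet : ∀ {C D} → GeneratedOpen B C → GeneratedOpen B D → GeneratedOpen B (C ∩ D)
  join : ∀ {I : Set} (C : I → Subset X) →
         (∀ i → GeneratedOpen B (C i)) → GeneratedOpen B (⋃ C)

generated : {X : Setoid 0ℓ 0ℓ} {J : Set} → (J → Subset X) → Topology X
generated B = record
  { Open       = GeneratedOpen B
  ; open-resp  = resp
  ; open-whole = all
  ; open-∩     = meet
  ; open-⋃     = join
  }

-- The index set is ^{<Λ}2.
cone : (Λ : Ordinal) → (Σ ∣ Λ ∣ λ a → Segment Λ a → Bool) → Subset (2^ Λ)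
cone Λ (a , s) = record
  { pred = λ x → ∀ (b : Segment Λ a) → x (proj₁ b) ≡ s b
  ; resp = λ x≈y p b → trans (sym (x≈y (proj₁ b))) (p b)
  }

boundedTopology : (Λ : Ordinal) → Topology (2^ Λ)
boundedTopology Λ = generated (cone Λ)

record WeaklyMeasurable (Λ : Ordinal) {X : Setoid 0ℓ 0ℓ} (𝒯 : Topology X) : Set₂ where
  open Topology 𝒯
  field
    𝔐      : Pred (Subset X) (lsuc 0ℓ)
    𝔐-resp : 𝔐 Respects _≐_
    𝔐-⋃    : ∀ {I : Set} → I ↣ ∣ Λ ∣ →
             (A : I → Subset X) → (∀ i → 𝔐 (A i)) → 𝔐 (⋃ A)
    𝔐-open : ∀ {A} → Open A → 𝔐 A

record Measure (Λ : Ordinal) {X : Setoid 0ℓ 0ℓ} {𝒯 : Topology X}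
               (M : WeaklyMeasurable Λ 𝒯)
               (𝕊 : PositivelyTotallyOrderedMonoid) (Σ𝕊 : InfinitarySum 𝕊) : Set₂ where
  open Topology 𝒯
  open WeaklyMeasurable M
  open PositivelyTotallyOrderedMonoid 𝕊
  open InfinitarySum Σ𝕊 using (Sum_≈_)
  field
    partialFunction : PartialFunction (_≐_ {X}) _≈_
  open PartialFunction partialFunction public renaming (Graph to μ_≈_)
  field
    𝔐⊆dom      : ∀ {A} → 𝔐 A → Dom A
    μ-∅        : μ ∅ ≈ 0#
    μ-whole    : ∃ λ v → μ whole ≈ v × 0# < v
    μ-mono     : ∀ {A B} → 𝔐 A → 𝔐 B → A ⊆ B →
                 ∀ {u v} → μ A ≈ u → μ B ≈ v → u ≤ v
    μ-additive : ∀ γ → γ <⁺ Λ → (A : ∣ γ ∣ → Subset X) → (∀ i → 𝔐 (A i)) →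
                 (∀ i j → ¬ (i ≡ j) → Disjoint (A i) (A j)) →
                 (v : ∣ γ ∣ → Carrier) → (∀ i → μ (A i) ≈ v i) →
                 ∃ λ w → Sum (γ , v) ≈ w × μ (⋃ A) ≈ w
    μ-point    : ∀ x → 𝔐 (singleton x) →
                 ∀ γ → γ <⁺ Λ → (A : ∣ γ ∣ → Subset X) → IsOpenLocalBasis x A →
                 (v : ∣ γ ∣ → Carrier) → (∀ i → μ (A i) ≈ v i) →
                 ∀ m → μ (singleton x) ≈ m → IsInf v m

  IsContinuous : Set₁
  IsContinuous = ∀ x → 𝔐 (singleton x) × μ (singleton x) ≈ 0#

{-# OPTIONS --safe #-}
module Submission where

-- Some θ < Λ satisfies 2^θ > Λ.  Take 𝕊 = {0 < 1} with + = max and let every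
-- subset of ^Λ2 be measurable: A gets measure 0 exactly when Λ many cones of
-- level θ cover A.  The whole space is not null because 2^θ > Λ, while cones of
-- level θ are null, hence every local basis has a null member.  Null sets are
-- closed under unions of size ≤ Λ because Λ × Λ injects into Λ.

open import Defs
open import Level using (0ℓ; Lift; lift; lower) renaming (suc to lsuc)
open import Axiom.DoubleNegationElimination
  using (DoubleNegationElimination; em⇒dne)
open import Axiom.ExcludedMiddle using (ExcludedMiddle)
open import Data.Bool.Base using (Bool; true; false; _∨_; b≤b; f≤t)
import Data.Bool.Base as Bool
import Data.Bool.Properties as Bool
open import Data.Empty using (⊥-elim)
open import Data.Fin.Base using (Fin; zero; suc; punchOut)
import Data.Fin.Properties as Fin
open import Data.Maybe.Base using (Maybe; just; nothing; maybe)
open import Data.Maybe.Properties using (just-injective)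
open import Data.Nat.Base using (zero; suc)
open import Data.Product.Base using (Σ; ∃; ∃₂; _×_; _,_; proj₁; proj₂; uncurry; map₂)
open import Data.Product.Function.NonDependent.Propositional using (_×-↣_)
open import Data.Product.Relation.Binary.Lex.Strict
  using (×-Lex; ×-compare; ×-wellFounded)
open import Data.Sum.Base using (_⊎_; inj₁; inj₂; [_,_]′)
open import Data.Unit.Base using (⊤; tt)
open import Function.Base using (_∘_; _on_; const; id)
open import Function.Bundles using (_↣_; _↔_; mk↣; mk⤖; module Inverse; module Injection)
open import Function.Construct.Composition using (_↣-∘_)
open import Function.Properties.Bijection using (⤖⇒↔)
open import Function.Properties.Inverse using (↔⇒↣; ↔-sym)
open import Induction.WellFounded using (WellFounded; WfRec; module All; module FixPoint)
open import Relation.Binary.Core using (Rel)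
open import Relation.Binary.Definitions using (tri<; tri≈; tri>)
open import Relation.Binary.PropositionalEquality
  using (_≡_; _≢_; refl; sym; trans; cong; cong₂; subst)
open import Relation.Binary.Structures using (IsStrictTotalOrder)
import Relation.Binary.Construct.On as On
open import Relation.Nullary.Decidable.Core
  using (yes; no; _because_; proof; map′)
open import Relation.Nullary.Negation.Core using (¬_; contradiction)
open import Relation.Nullary.Reflects using (Reflects; ofʸ; ofⁿ; det)
open import Relation.Unary as Pred using (Pred)

map-reflects : ∀ {a b} {A : Set a} {B : Set b} {t} →
               (A → B) → (B → A) → Reflects A t → Reflects B t
map-reflects f g r = proof (map′ f g (_ because r))

-- Injections, finite sets and squares.

segment↣ : (α : Ordinal) (a : ∣ α ∣) → Segment α a ↣ ∣ α ∣
segment↣ α a = mk↣ {to = proj₁} λ { {b , p} {_ , q} refl → cong (b ,_) (<-irrelevant p q) }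
  where open Ordinal α

Maybe↣Fin : ∀ {A : Set} {n} → A ↣ Fin n → Maybe A ↣ Fin (suc n)
Maybe↣Fin {A} f = mk↣ {to = to} injective
  where
  to : Maybe A → Fin _
  to = maybe (suc ∘ Injection.to f) zero

  injective : ∀ {x y} → to x ≡ to y → x ≡ y
  injective {just _}  {just _}  e = cong just (Injection.injective f (Fin.suc-injective e))
  injective {nothing} {nothing} _ = refl

-- The diagonal embeds `A` and leaves the pair `(a , b)` free to receive `nothing`. This lets a set
-- that contains its own square absorb an extra point.
Maybe↣× : ∀ {A : Set} {a b : A} → a ≢ b → Maybe A ↣ (A × A)
Maybe↣× {A} {a} {b} a≢b = mk↣ {to = to} injective
  where
  to : Maybe A → A × A
  to = maybe (λ x → x , x) (a , b)

  injective : ∀ {x y} → to x ≡ to y → x ≡ y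
  injective {just _}  {just _}  refl = refl
  injective {just _}  {nothing} refl = contradiction refl a≢b
  injective {nothing} {just _}  refl = contradiction refl a≢b
  injective {nothing} {nothing} _    = refl

IsFinite : Set → Set
IsFinite A = ∃ λ n → A ↣ Fin n

finite-↣ : ∀ {A B : Set} → A ↣ B → IsFinite B → IsFinite A
finite-↣ f (n , g) = n , g ↣-∘ f

finite-× : ∀ {A B : Set} → IsFinite A → IsFinite B → IsFinite (A × B)
finite-× (_ , f) (_ , g) = _ , ↔⇒↣ (↔-sym Fin.*↔×) ↣-∘ (f ×-↣ g)

-- This disjunction is the induction hypothesis: segments of an infinite well-order may be finite,
-- and then their squares need not inject back.
FiniteOrSquare : Set → Set
FiniteOrSquare A = IsFinite A ⊎ ((A × A) ↣ A)

finiteOrSquare-resp : ∀ {A B : Set} → A ↣ B → B ↣ A →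
                      FiniteOrSquare A → FiniteOrSquare B
finiteOrSquare-resp f g (inj₁ fin) = inj₁ (finite-↣ g fin)
finiteOrSquare-resp f g (inj₂ sq)  = inj₂ (f ↣-∘ (sq ↣-∘ (g ×-↣ g)))

-- Well-ordering the pairs of elements of an ordinal.

module Linear (α : Ordinal) where
  open Ordinal α
  open IsStrictTotalOrder isStrictTotalOrder public
    using (compare; irrefl) renaming (trans to <-trans)

  infixl 6 _⊔_
  _⊔_ : ∣ α ∣ → ∣ α ∣ → ∣ α ∣
  x ⊔ y with compare x y
  ... | tri< _ _ _ = y
  ... | tri≈ _ _ _ = y
  ... | tri> _ _ _ = x

  ⊔-upperˡ : ∀ x y → ¬ (x ⊔ y) < x
  ⊔-upperˡ x y p with compare x y
  ... | tri< _ _ q = q p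
  ... | tri≈ _ _ q = q p
  ... | tri> _ _ _ = irrefl refl p

  ⊔-upperʳ : ∀ x y → ¬ (x ⊔ y) < y
  ⊔-upperʳ x y p with compare x y
  ... | tri< _ _ _ = irrefl refl p
  ... | tri≈ _ _ _ = irrefl refl p
  ... | tri> q _ _ = q p

  -- The hypothesis says that `b` is at most `c`, so `nothing` stands for `c` itself: a closed
  -- segment becomes `Maybe` of an open one.
  below : ∀ {c} b → ¬ c < b → Maybe (Segment α c)
  below {c} b c≮b with compare b c
  ... | tri< b<c _ _ = just (b , b<c)
  ... | tri≈ _ _ _   = nothing
  ... | tri> _ _ c<b = contradiction c<b c≮b

  below-injective : ∀ {c b b′} (p : ¬ c < b) (p′ : ¬ c < b′) →
                    below b p ≡ below b′ p′ → b ≡ b′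
  below-injective {c} {b} {b′} p p′ e with compare b c | compare b′ c
  ... | tri< _ _ _   | tri< _ _ _    = cong proj₁ (just-injective e)
  ... | tri≈ _ b≡c _ | tri≈ _ b′≡c _ = trans b≡c (sym b′≡c)
  ... | tri> _ _ c<b | _             = contradiction c<b p
  ... | tri< _ _ _   | tri> _ _ c<b′ = contradiction c<b′ p′
  ... | tri≈ _ _ _   | tri> _ _ c<b′ = contradiction c<b′ p′

  -- Gödel's well-ordering of pairs.  Its point is that an initial segment is
  -- contained in the square of a proper initial segment of α.
  key : ∣ α ∣ × ∣ α ∣ → ∣ α ∣ × ∣ α ∣ × ∣ α ∣
  key (x , y) = x ⊔ y , x , y

  infix 4 _<ₗ_ _<²_
  _<ₗ_ : Rel (∣ α ∣ × ∣ α ∣ × ∣ α ∣) 0ℓ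
  _<ₗ_ = ×-Lex _≡_ _<_ (×-Lex _≡_ _<_ _<_)

  _<²_ : Rel (∣ α ∣ × ∣ α ∣) 0ℓ
  _<²_ = _<ₗ_ on key

  <²-wellFounded : WellFounded _<²_
  <²-wellFounded = On.wellFounded key
    (×-wellFounded <-wellFounded (×-wellFounded <-wellFounded <-wellFounded))

  <²-connected : ∀ p q → p ≢ q → p <² q ⊎ q <² p
  <²-connected p q p≢q
    with ×-compare sym compare (×-compare sym compare compare) (key p) (key q)
  ... | tri< l _ _               = inj₁ l
  ... | tri≈ _ (_ , e₁ , e₂) _ = contradiction (cong₂ _,_ e₁ e₂) p≢q
  ... | tri> _ _ g               = inj₂ g

  <²⇒max-≮ : ∀ {p q} → p <² q → ¬ uncurry _⊔_ q < uncurry _⊔_ p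
  <²⇒max-≮ (inj₁ l)       g = irrefl refl (<-trans l g)
  <²⇒max-≮ (inj₂ (e , _)) g = irrefl (sym e) g

  ≮-trans : ∀ {a b c} → ¬ a < b → ¬ b < c → ¬ a < c
  ≮-trans {a} {b} {c} a≮b b≮c a<c with compare a b
  ... | tri< a<b _ _  = a≮b a<b
  ... | tri≈ _ refl _ = b≮c a<c
  ... | tri> _ _ b<a  = b≮c (<-trans b<a a<c)

  -- The maximum is compared first, so both coordinates of a pair preceding `p` are at most the
  -- maximum of `p`; `below` then encodes each of them.
  <²-bounded : ∀ {A : Set} {p} (g : A ↣ (∣ α ∣ × ∣ α ∣)) →
               (∀ x → Injection.to g x <² p) →
               let D = Segment α (uncurry _⊔_ p) in A ↣ (Maybe D × Maybe D)
  <²-bounded {A} {p} g g<p = mk↣ {to = to} λ {x} {y} e →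
    injective (cong₂ _,_ (below-injective (left x) (left y) (cong proj₁ e))
                         (below-injective (right x) (right y) (cong proj₂ e)))
    where
    open Injection g using (injective) renaming (to to g′)
    D = Segment α (uncurry _⊔_ p)

    left : ∀ x → ¬ uncurry _⊔_ p < proj₁ (g′ x)
    left x = ≮-trans (<²⇒max-≮ (g<p x)) (uncurry ⊔-upperˡ (g′ x))

    right : ∀ x → ¬ uncurry _⊔_ p < proj₂ (g′ x)
    right x = ≮-trans (<²⇒max-≮ (g<p x)) (uncurry ⊔-upperʳ (g′ x))

    to : A → Maybe D × Maybe D
    to x = below (proj₁ (g′ x)) (left x) , below (proj₂ (g′ x)) (right x)

-- Squares of infinite well-ordered sets, by classical reasoning.

module Cardinality (em : ExcludedMiddle 0ℓ) where

  dne : DoubleNegationElimination 0ℓ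
  dne = em⇒dne em

  ¬∀⇒∃¬ : {A : Set} {P : A → Set} → ¬ (∀ x → P x) → ∃ λ x → ¬ P x
  ¬∀⇒∃¬ ¬∀ = dne λ ¬∃ → ¬∀ λ x → dne λ ¬p → ¬∃ (x , ¬p)

  -- As long as the injection misses a value, punching that value out lowers `n`; the process stops
  -- at a surjection. This links `IsFinite` to the bijections in `IsInfinite`.
  finite⇒↔Fin : ∀ {A : Set} → IsFinite A → ∃ λ n → A ↔ Fin n
  finite⇒↔Fin {A} (n , f) = go n f
    where
    go : ∀ n → A ↣ Fin n → ∃ λ m → A ↔ Fin m
    go n f with em {∀ j → ∃ λ x → Injection.to f x ≡ j}
    ... | yes onto = n , ⤖⇒↔ (mk⤖ (Injection.injective f , λ j →
                       map₂ (λ { e refl → e }) (onto j)))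
    go zero    f | no ¬onto = contradiction (λ ()) ¬onto
    go (suc n) f | no ¬onto with ¬∀⇒∃¬ ¬onto
    ... | j , missed = go n (mk↣ {to = λ x → punchOut (j≢ x)} λ {x} {y} e →
            Injection.injective f (Fin.punchOut-injective (j≢ x) (j≢ y) e))
      where
      j≢ : ∀ x → j ≢ Injection.to f x
      j≢ x e = missed (x , sym e)

  -- With two distinct elements, `Maybe A` embeds in `A × A` and hence in `A`, so its square does
  -- too. Otherwise `A` has at most one element and is finite.
  maybe-square : ∀ {A : Set} → FiniteOrSquare A →
                 IsFinite A ⊎ ((Maybe A × Maybe A) ↣ A)
  maybe-square (inj₁ fin) = inj₁ fin
  maybe-square {A} (inj₂ sq) with em {∃₂ λ (a b : A) → a ≢ b}
  ... | yes (_ , _ , a≢b) = inj₂ (sq ↣-∘ (absorb ×-↣ absorb))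
    where
    absorb : Maybe A ↣ A
    absorb = sq ↣-∘ Maybe↣× a≢b
  ... | no ¬two = inj₁ (1 , mk↣ {to = λ _ → zero} λ {x} {y} _ → dne λ x≢y → ¬two (x , y , x≢y))

  module Minimum (α : Ordinal) where
    open Ordinal α
    open Linear α using (compare)

    IsLeast : Pred ∣ α ∣ 0ℓ → Pred ∣ α ∣ 0ℓ
    IsLeast Q x = Q x × (∀ y → Q y → ¬ y < x)

    least : ∀ {Q} → ∃ Q → ∃ (IsLeast Q)
    least {Q} (x , q) = wfRec (λ x → Q x → ∃ (IsLeast Q)) step x q
      where
      open All <-wellFounded 0ℓ using (wfRec)

      step : ∀ x → WfRec _<_ (λ x → Q x → ∃ (IsLeast Q)) x → Q x → ∃ (IsLeast Q)
      step x rec q with em {∃ λ y → Q y × y < x}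
      ... | yes (_ , q′ , y<x) = rec y<x q′
      ... | no ¬below = x , q , λ y q′ y<x → ¬below (y , q′ , y<x)

    -- The value at an empty predicate is the default.
    min : Pred ∣ α ∣ 0ℓ → ∣ α ∣ → ∣ α ∣
    min Q d with em {∃ (IsLeast Q)}
    ... | yes (x , _) = x
    ... | no _        = d

    min-∈ : ∀ {Q d} → ∃ Q → Q (min Q d)
    min-∈ {Q} q with em {∃ (IsLeast Q)}
    ... | yes (_ , qx , _) = qx
    ... | no ¬least        = contradiction (least q) ¬least

    -- Least elements are unique, and both sides share the default. This replaces function
    -- extensionality wherever a value is chosen by `min`.
    min-cong : ∀ {P Q d} → (∀ {x} → P x → Q x) → (∀ {x} → Q x → P x) →
               min P d ≡ min Q d
    min-cong {P} {Q} P⊆Q Q⊆P with em {∃ (IsLeast P)} | em {∃ (IsLeast Q)}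
    ... | no _  | no _  = refl
    ... | no ¬p | yes (x , q , x≤) =
      contradiction (x , Q⊆P q , λ y p → x≤ y (P⊆Q p)) ¬p
    ... | yes (x , p , x≤) | no ¬q =
      contradiction (x , P⊆Q p , λ y q → x≤ y (Q⊆P q)) ¬q
    ... | yes (x , p , x≤) | yes (y , q , y≤) with compare x y
    ...   | tri< x<y _ _ = contradiction x<y (y≤ x (P⊆Q p))
    ...   | tri≈ _ x≡y _ = x≡y
    ...   | tri> _ _ y<x = contradiction y<x (x≤ y (Q⊆P q))

  -- The Mostowski collapse, sending p to the least element not hit before p.
  module Collapse
    (α : Ordinal) {P : Set} {_<_ : Rel P 0ℓ} (wf : WellFounded _<_)
    (connected : ∀ p q → p ≢ q → p < q ⊎ q < p)
    (small : ∀ p → ¬ Σ (∣ α ∣ ↣ P) λ g → ∀ y → Injection.to g y < p)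
    where
    open Minimum α

    -- Were `α` empty, the empty map would contradict `small`. The element obtained serves as the
    -- default of `min`.
    inhabited : P → ∣ α ∣
    inhabited p = dne λ ¬a → small p
      (mk↣ {to = ⊥-elim ∘ ¬a} (λ {y} → contradiction y ¬a) , λ y → contradiction y ¬a)

    Avoids : ∀ {p} → WfRec _<_ (λ _ → ∣ α ∣) p → Pred ∣ α ∣ 0ℓ
    Avoids {p} rec y = ∀ {q} (q<p : q < p) → rec q<p ≢ y

    step : ∀ p → WfRec _<_ (λ _ → ∣ α ∣) p → ∣ α ∣
    step p rec = min (Avoids rec) (inhabited p)

    step-ext : ∀ p {rec rec′ : WfRec _<_ (λ _ → ∣ α ∣) p} →
               (∀ {q} (q<p : q < p) → rec q<p ≡ rec′ q<p) →
               step p rec ≡ step p rec′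
    step-ext p ext = min-cong
      (λ avoids q<p e → avoids q<p (trans (ext q<p) e))
      (λ avoids q<p e → avoids q<p (trans (sym (ext q<p)) e))

    collapse : P → ∣ α ∣
    collapse = All.wfRec wf 0ℓ (λ _ → ∣ α ∣) step

    -- If the predecessors of `p` hit every element of `α`, choosing one preimage for each element
    -- would inject `α` into those predecessors, against `small`.
    free : ∀ p → ∃ (Avoids {p} λ {q} _ → collapse q)
    free p = dne λ ¬free →
      let hit : ∀ y → ∃ λ q → q < p × collapse q ≡ y
          hit y = dne λ ¬hit → ¬free (y , λ {q} q<p e → ¬hit (q , q<p , e))
      in small p (mk↣ {to = proj₁ ∘ hit} (λ {y} {z} e →
           trans (sym (proj₂ (proj₂ (hit y))))
                 (trans (cong collapse e) (proj₂ (proj₂ (hit z)))))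
           , proj₁ ∘ proj₂ ∘ hit)

    collapse-≢ : ∀ {p q} → q < p → collapse q ≢ collapse p
    collapse-≢ {p} q<p e =
      min-∈ (free p) q<p (trans e (FixPoint.unfold-wfRec wf (λ _ → ∣ α ∣) step step-ext))

    collapse↣ : P ↣ ∣ α ∣
    collapse↣ = mk↣ {to = collapse} λ {p} {q} e → dne λ p≢q →
      [ (λ p<q → collapse-≢ p<q e) , (λ q<p → collapse-≢ q<p (sym e)) ]′ (connected p q p≢q)

  -- If `α` injects into a proper segment, the two are equinumerous and the claim transfers from the
  -- segment. Otherwise `α` is finite, or it is too large to inject into the predecessors of any
  -- pair, and the collapse embeds its square.
  finiteOrSquare-step : ∀ α → (∀ a → FiniteOrSquare (Segment α a)) → FiniteOrSquare ∣ α ∣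
  finiteOrSquare-step α rec with em {∃ λ a → ∣ α ∣ ↣ Segment α a}
  ... | yes (a , f)   = finiteOrSquare-resp (segment↣ α a) f (rec a)
  ... | no ¬collapses with em {IsFinite ∣ α ∣}
  ...   | yes fin     = inj₁ fin
  ...   | no infinite = inj₂ (Collapse.collapse↣ α <²-wellFounded <²-connected small)
    where
    open Linear α

    -- Those predecessors lie in the square of `Maybe D` for a proper segment `D`. If `D` is finite,
    -- so is `α`; if not, the square embeds in `D`, and then so does `α`.
    small : ∀ p → ¬ Σ (∣ α ∣ ↣ (∣ α ∣ × ∣ α ∣)) λ g → ∀ y → Injection.to g y <² p
    small p (g , g<p) with maybe-square (rec (uncurry _⊔_ p))
    ... | inj₁ (n , f) = infinite (finite-↣ (<²-bounded g g<p)
                           (finite-× (suc n , Maybe↣Fin f) (suc n , Maybe↣Fin f)))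
    ... | inj₂ sq      = ¬collapses (uncurry _⊔_ p , sq ↣-∘ <²-bounded g g<p)

  finiteOrSquare : ∀ α → FiniteOrSquare ∣ α ∣
  finiteOrSquare α = finiteOrSquare-step α (wfRec _ segment)
    where
    open Ordinal α
    open Linear α using (<-trans)
    open All <-wellFounded 0ℓ using (wfRec)

    -- A segment of `α ↓ a` is, up to forgetting order proofs, the segment of `α` below the same
    -- element, so the hypothesis there can be transported.
    segment : ∀ a → WfRec _<_ (FiniteOrSquare ∘ Segment α) a → FiniteOrSquare (Segment α a)
    segment a rec = finiteOrSquare-step (α ↓ a) λ (b , b<a) →
      finiteOrSquare-resp
        (mk↣ {to = λ (c , c<b) → (c , <-trans c<b b<a) , c<b}
          λ e → Injection.injective (segment↣ α b) (cong (proj₁ ∘ proj₁) e))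
        (mk↣ {to = λ ((c , _) , c<b) → c , c<b}
          λ e → Injection.injective (segment↣ (α ↓ a) (b , b<a))
                  (Injection.injective (segment↣ α a) (cong proj₁ e)))
        (rec b<a)

  infinite⇒square : ∀ α → IsInfinite α → (∣ α ∣ × ∣ α ∣) ↣ ∣ α ∣
  infinite⇒square α infinite with finiteOrSquare α
  ... | inj₁ fin = contradiction (finite⇒↔Fin fin) infinite
  ... | inj₂ sq  = sq

  leftInverse : ∀ {A B : Set} → A ↣ B → A → B → A
  leftInverse f d y with em {∃ λ x → Injection.to f x ≡ y}
  ... | yes (x , _) = x
  ... | no _        = d

  leftInverse-to : ∀ {A B : Set} (f : A ↣ B) {d} x →
                   leftInverse f d (Injection.to f x) ≡ x
  leftInverse-to f x with em {∃ λ x′ → Injection.to f x′ ≡ Injection.to f x}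
  ... | yes (_ , e) = Injection.injective f e
  ... | no ¬hit     = contradiction (x , refl) ¬hit

-- The two-element monoid and its infinitary sum.

boolMonoid : PositivelyTotallyOrderedMonoid
boolMonoid = record
  { monoid       = record { isMonoid = Bool.∨-isMonoid }
  ; _≤_          = Bool._≤_
  ; isTotalOrder = Bool.≤-isTotalOrder
  ; +-mono-≤     = ∨-mono-≤
  ; 0-minimum    = Bool.≤-minimum
  ; nontrivial   = true , λ ()
  }
  where
  ∨-mono-≤ : ∀ {a b c d} → a Bool.≤ b → c Bool.≤ d → (a ∨ c) Bool.≤ (b ∨ d)
  ∨-mono-≤ {true}  b≤b q = b≤b
  ∨-mono-≤ {false} b≤b q = q
  ∨-mono-≤ f≤t q = Bool.≤-maximum _

open PositivelyTotallyOrderedMonoid boolMonoid using (Sequence; _∼_; _↾_; sum)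

reflects-≤ : ∀ {a b} {A : Set a} {B : Set b} {s t} →
             Reflects A s → Reflects B t → (A → B) → s Bool.≤ t
reflects-≤ (ofⁿ _) _        f = Bool.≤-minimum _
reflects-≤ (ofʸ _) (ofʸ _)  f = b≤b
reflects-≤ (ofʸ a) (ofⁿ ¬b) f = contradiction (f a) ¬b

HasTrue : Sequence → Set
HasTrue (_ , s) = ∃ λ i → s i ≡ true

hasTrue-resp-∼ : ∀ {s t} → s ∼ t → HasTrue s → HasTrue t
hasTrue-resp-∼ (f , s≈t) (i , e) = _≅_.to f i , trans (sym (s≈t i)) e

hasTrue-resp-∼⁻¹ : ∀ {s t} → s ∼ t → HasTrue t → HasTrue s
hasTrue-resp-∼⁻¹ {t = _ , t} (f , s≈t) (j , e) =
  from j , trans (s≈t (from j)) (trans (cong t (strictlyInverseˡ j)) e)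
  where open Inverse (_≅_.bijection f) using (from; strictlyInverseˡ)

reflects-sum : ∀ n (s : Fin n → Bool) → Reflects (∃ λ i → s i ≡ true) (sum s)
reflects-sum zero    s = ofⁿ λ ()
reflects-sum (suc n) s with s zero in e
... | true  = ofʸ (zero , e)
... | false = map-reflects
  (λ (i , p) → suc i , p)
  (λ { (zero , p) → contradiction (trans (sym e) p) (λ ()) ; (suc i , p) → i , p })
  (reflects-sum n (s ∘ suc))

-- The sum of any sequence is the supremum of its terms, which for finite sequences is the iterated
-- disjunction.
boolSum : ExcludedMiddle 0ℓ → InfinitarySum boolMonoid
boolSum em = record
  { partialFunction = record
    { Graph      = λ s v → Lift (lsuc 0ℓ) (Reflects (HasTrue s) v)
    ; respects   = λ { s∼t refl (lift r) → lift
        (map-reflects (hasTrue-resp-∼ s∼t) (hasTrue-resp-∼⁻¹ s∼t) r) }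
    ; functional = λ (lift r) (lift r′) → det r r′
    }
  ; sum-empty  = λ s → lift (ofⁿ λ ())
  ; sum-finite = λ n s v (lift r) → det r (reflects-sum (suc n) s)
  ; continuity = λ (γ , s) v (lift r) (_ , unbounded) _ →
      (λ (a , w , lift r′) → reflects-≤ r′ r λ ((i , _) , e) → i , e)
      , λ u upper → least {γ} s r unbounded u upper
  }
  where
  -- A true term at `i` already occurs in the initial segment below any later index, and the limit
  -- length provides such an index.
  least : ∀ {γ} (s : ∣ γ ∣ → Bool) {v} → Reflects (HasTrue (γ , s)) v →
          (∀ a → ∃ λ b → Ordinal._<_ γ a b) → ∀ u →
          (∀ (i : ∃ λ a → ∃ λ w → Lift (lsuc 0ℓ) (Reflects (HasTrue ((γ , s) ↾ a)) w)) →
             proj₁ (proj₂ i) Bool.≤ u) →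
          v Bool.≤ u
  least s (ofⁿ _)       unbounded u upper = Bool.≤-minimum u
  least s (ofʸ (i , e)) unbounded u upper with unbounded i
  ... | b , i<b = upper (b , true , lift (ofʸ ((i , i<b) , e)))

-- Null sets at level `θ` and the measure they define.

module Construction
  (em : ExcludedMiddle 0ℓ) (Λ : Ordinal) (infinite : IsInfinite Λ)
  (θ : ∣ Λ ∣) (2^θ⋠Λ : ¬ (2^ (Λ ↓ θ) ≼ setOf Λ)) where
  open Cardinality em
  open Minimum Λ
  open Subset using (pred)

  Word : Set
  Word = Segment Λ θ → Bool

  𝒯 : Topology (2^ Λ)
  𝒯 = boundedTopology Λ

  levelCone : Word → Subset (2^ Λ)
  levelCone s = cone Λ (θ , s)

  -- Repetitions in `c` are allowed, so this means a cover by at most `Λ` many cones.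
  Null : Pred (∣ Λ ∣ → Bool) 0ℓ → Set
  Null P = ∃ λ (c : ∣ Λ ∣ → Word) → P Pred.⊆ pred (⋃ (levelCone ∘ c))

  null-⊆ : ∀ {P Q} → P Pred.⊆ Q → Null Q → Null P
  null-⊆ P⊆Q (c , covers) = c , λ x∈P → covers (P⊆Q x∈P)

  null-levelCone : ∀ s → Null (pred (levelCone s))
  null-levelCone s = const s , λ x∈ → θ , x∈

  null-∅ : Null Pred.∅
  null-∅ = const (const false) , λ ()

  null-singleton : ∀ x → Null (pred (singleton {2^ Λ} x))
  null-singleton x = null-⊆ (λ x≈y b → sym (x≈y (proj₁ b))) (null-levelCone (x ∘ proj₁))

  null-⋃ : ∀ {I : Set} → I ↣ ∣ Λ ∣ → (A : I → Subset (2^ Λ)) →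
           (∀ i → Null (pred (A i))) → Null (pred (⋃ A))
  null-⋃ {I} g A null with em {I}
  ... | no ¬i = null-⊆ (λ (i , _) → contradiction i ¬i) null-∅
  -- The index `l` decodes to a pair `(i , j)` naming the `j`-th cone that covers `A i`. The pair
  -- `(i₀ , θ)` is only a default for indices outside the image of `pair`.
  ... | yes i₀ = (λ l → code (leftInverse pair (i₀ , θ) l)) , λ {x} (i , x∈A) →
      let j , x∈ = proj₂ (null i) x∈A in
      Injection.to pair (i , j) ,
      subst (λ p → x ∈ levelCone (code p)) (sym (leftInverse-to pair (i , j))) x∈
    where
    pair : (I × ∣ Λ ∣) ↣ ∣ Λ ∣
    pair = infinite⇒square Λ infinite ↣-∘ (g ×-↣ mk↣ {to = id} id)

    code : I × ∣ Λ ∣ → Word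
    code (i , j) = proj₁ (null i) j

  -- Padding a word with `false` gives a point of the whole space, so that a cover of the space also
  -- captures every word.
  extend : Word → ∣ Λ ∣ → Bool
  extend s b with em {Ordinal._<_ Λ b θ}
  ... | yes b<θ = s (b , b<θ)
  ... | no _    = false

  extend-restricts : ∀ s (b : Segment Λ θ) → extend s (proj₁ b) ≡ s b
  extend-restricts s (b , b<θ) with em {Ordinal._<_ Λ b θ}
  ... | yes p = cong (λ q → s (b , q)) (Ordinal.<-irrelevant Λ p b<θ)
  ... | no b≮θ = contradiction b<θ b≮θ

  -- Taking the least index of a covering cone makes the injection respect
  -- pointwise equality of words.
  ¬null-whole : ¬ Null Pred.U
  ¬null-whole (c , covers) = 2^θ⋠Λ record
    { to        = index
    ; cong      = λ s≈t → min-cong (λ e b → trans (sym (s≈t b)) (e b))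
                                   (λ e b → trans (s≈t b) (e b))
    ; injective = λ {s} {t} e b → trans (index-correct s b)
        (trans (cong (λ l → c l b) e) (sym (index-correct t b)))
    }
    where
    index : Word → ∣ Λ ∣
    index s = min (λ l → ∀ b → s b ≡ c l b) θ

    index-correct : ∀ s b → s b ≡ c (index s) b
    index-correct s = let l , x∈ = covers {extend s} tt in
      min-∈ {Q = λ l → ∀ b → s b ≡ c l b}
        (l , λ b → trans (sym (extend-restricts s b)) (x∈ b))

  M : WeaklyMeasurable Λ 𝒯
  M = record
    { 𝔐      = λ _ → Lift (lsuc 0ℓ) ⊤
    ; 𝔐-resp = λ _ _ → _
    ; 𝔐-⋃    = λ _ _ _ → _
    ; 𝔐-open = λ _ → _
    }

  -- A non-null piece makes the union non-null by monotonicity. Conversely, if all pieces are null,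
  -- so is their union, as there are at most `Λ` of them.
  additive : ∀ γ → γ <⁺ Λ → (A : ∣ γ ∣ → Subset (2^ Λ)) (v : ∣ γ ∣ → Bool) →
             (∀ i → Reflects (¬ Null (pred (A i))) (v i)) →
             ∀ {w} → Reflects (HasTrue (γ , v)) w → Reflects (¬ Null (pred (⋃ A))) w
  additive γ γ≼Λ A v r = map-reflects to from
    where
    to : HasTrue (γ , v) → ¬ Null (pred (⋃ A))
    to (i , vi≡true) null with v i | r i
    to (i , refl) null | true | ofʸ ¬null = ¬null (null-⊆ (λ x∈ → i , x∈) null)

    from : ¬ Null (pred (⋃ A)) → HasTrue (γ , v)
    from ¬null = dne λ ¬true → ¬null (null-⋃ γ≼Λ A λ i → dne λ ¬nullᵢ →
      ¬true (i , det (r i) (ofʸ ¬nullᵢ)))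

  null-value : ∀ {P v} → Null P → Reflects (¬ Null P) v → v ≡ false
  null-value null r = det r (ofⁿ λ ¬null → ¬null null)

  μ : Measure Λ M boolMonoid (boolSum em)
  μ = record
    { partialFunction = record
      { Graph      = λ A v → Lift (lsuc 0ℓ) (Reflects (¬ Null (pred A)) v)
      ; respects   = λ { (A⊆B , B⊆A) refl (lift r) → lift (map-reflects
          (λ ¬null null → ¬null (null-⊆ A⊆B null))
          (λ ¬null null → ¬null (null-⊆ B⊆A null)) r) }
      ; functional = λ (lift r) (lift r′) → det r r′
      }
    ; 𝔐⊆dom      = λ _ → _ , lift (proof em)
    ; μ-∅        = lift (ofⁿ λ ¬null → ¬null null-∅)
    ; μ-whole    = true , lift (ofʸ ¬null-whole) , f≤t , λ ()
    ; μ-mono     = λ _ _ A⊆B (lift r) (lift r′) →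
        reflects-≤ r r′ λ ¬null null → ¬null (null-⊆ A⊆B null)
    ; μ-additive = λ γ γ≼Λ A _ _ v r →
        _ , lift (proof em) , lift (additive γ γ≼Λ A v (lower ∘ r) (proof em))
    ; μ-point    = λ x _ γ _ A basis v r m (lift rx) →
        (λ i → subst (Bool._≤ v i) (sym (null-value (null-singleton x) rx)) (Bool.≤-minimum _))
        , λ u u≤ →
          -- The cone of level `θ` around `x` is an open null neighbourhood, so some basis member
          -- inside it is null and forces the infimum down to `false`.
          let i , Aᵢ⊆ = proj₂ basis (levelCone (x ∘ proj₁)) (base _) (λ _ → refl)
              vᵢ≡false = null-value (null-⊆ Aᵢ⊆ (null-levelCone _)) (lower (r i))
          in subst (u Bool.≤_) (trans vᵢ≡false (sym (null-value (null-singleton x) rx))) (u≤ i)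
    }

  μ-continuous : Measure.IsContinuous μ
  μ-continuous x = _ , lift (ofⁿ λ ¬null → ¬null (null-singleton x))

corollary8p6 : Classical →
    ∀ (Λ : Ordinal) → IsCardinal Λ → IsInfinite Λ →
    ∀ (κ : Ordinal) → κ Is2^< Λ → setOf Λ ≺ setOf κ →
    Σ PositivelyTotallyOrderedMonoid λ 𝕊 →
    Σ (InfinitarySum 𝕊) λ Σ𝕊 →
    Σ (WeaklyMeasurable Λ (boundedTopology Λ)) λ M →
    Σ (Measure Λ M 𝕊 Σ𝕊) λ μ →
    Measure.IsContinuous μ
corollary8p6 em Λ isCardinal infinite κ κ≡2^<Λ (_ , κ⋠Λ) =
  boolMonoid , boolSum em , M , μ , μ-continuous
  where
  open Cardinality em using (dne)

  -- If every such power injected into `Λ`, then `Λ` would be an upper bound in the definition of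
  -- `κ`, and leastness would inject `κ` into `Λ`.
  large : ∃ λ θ → ¬ (2^ (Λ ↓ θ) ≼ setOf Λ)
  large = dne λ ¬large → κ⋠Λ (_Is2^<_.least κ≡2^<Λ Λ isCardinal
    λ θ _ → dne λ 2^θ⋠Λ → ¬large (θ , 2^θ⋠Λ))

  open Construction em Λ infinite (proj₁ large) (proj₂ large)
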